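{- Let $A$ be a Discoverer algorithm for the source detection game with consistent source behavior on known static graphs. Then there is a Discoverer algorithm $A^u$ for the source detection game with consistent source behavior on unknown static graphs with the following property. If $A$ wins its game within $O(f(n))$ infections with probability $g(n)$, then $A^u$ also wins its game within $O(f(n))$ infections with probability $g(n)$.
   Context: A temporal graph $\mathcal{G}=(V,E,\lambda)$ with lifetime $T_{\max}$ consists of a finite simple undirected graph $(V,E)$, called the underlying static graph, together with a labeling $\lambda\colon E\to\{1,\dots,T_{\max}\}$. The edge $e$ is present only at time $\lambda(e)$. Write $n=|V|$. Infections follow the SIR model with duration $\delta\ge1$. A node may be seed-infected at some time. A susceptible node $u$ becomes infected at time $t$ iff some neighbor $v$ is infectious at time $t$ and $\lambda(uv)=t$; exactly one such neighbor counts as its infector. The node $u$ is then infectious at times $t+1,\dots,t+\delta$ and resistant afterwards. SD game: an Adversary fixes the temporal graph, $T_{\max}$, $\delta$, and a source node $s$. The Discoverer is told $V$, $T_{\max}$, $\delta$, and, in the known-static-graph setting, also $E$ (never $\lambda$); in the unknown-static-graph setting $E$ is not revealed. In each round the Discoverer watches one node. All nodes start susceptible, the source is seed-infected, and an infection chain unfolds. The Discoverer learns whether, when, and by which neighbor the watched node was infected (or that it was the seed). Consistent source behavior means the same seed time and the same infection chain are used in every round. The Discoverer eventually names a node and wins iff it is $s$. The number of infections (price of detection) is the total number of nodes infected, summed over all rounds, until the Discoverer stops.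
   Formalization: Randomized Discoverer algorithms are taken to be uniform choices among finitely many deterministic adaptive strategies, so all probabilities are rational, and the success probability g(n) is rational-valued instead of real-valued. -}

module Defs where

open import Data.Nat using (ℕ; zero; suc; _+_; _*_; _≤_; _<_; _≤ᵇ_)
open import Data.Bool using (Bool; true; false; _∧_)
open import Data.Fin using (Fin)
open import Data.Fin.Properties using (_≟_)
open import Data.List using (List; []; _∷_)
open import Data.Maybe using (Maybe; just; nothing)
open import Data.Product using (Σ; _×_; _,_; ∃)
open import Data.Integer using (+_)
open import Data.Rational using (ℚ; _/_) renaming (_≤_ to _≤ℚ_)
open import Relation.Binary.PropositionalEquality using (_≡_)
open import Relation.Nullary.Decidable using (⌊_⌋)

-- Status of a node in the (single, fixed) infection chain:
--   healthy      : never infected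
--   seed t       : seed-infected at time t
--   infBy v t    : infected at time t, infector v
data Status (n : ℕ) : Set where
  healthy : Status n
  seed    : ℕ → Status n
  infBy   : Fin n → ℕ → Status n

infTime : ∀ {n} → Status n → Maybe ℕ
infTime healthy     = nothing
infTime (seed t)    = just t
infTime (infBy _ t) = just t

isInfected : ∀ {n} → Status n → Bool
isInfected healthy     = false
isInfected (seed _)    = true
isInfected (infBy _ _) = true

Infectious : ∀ {n} → (Fin n → Status n) → ℕ → Fin n → ℕ → Set
Infectious r δ v t = Σ ℕ λ tv → infTime (r v) ≡ just tv × tv < t × t ≤ tv + δ

-- An instance chosen by the Adversary: a temporal graph on n nodes
-- (simple undirected static graph + labeling of its edges into 1..T),
-- lifetime T, duration δ ≥ 1, source s, seed time t0, and an SIR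
-- infection chain r consistent with all of it.
record Instance (n : ℕ) : Set where
  field
    adj      : Fin n → Fin n → Bool
    adjSym   : ∀ u v → adj u v ≡ adj v u
    adjIrr   : ∀ u → adj u u ≡ false
    T        : ℕ
    lab      : Fin n → Fin n → ℕ           -- only meaningful on edges
    labSym   : ∀ u v → lab u v ≡ lab v u
    labRange : ∀ u v → adj u v ≡ true → 1 ≤ lab u v × lab u v ≤ T
    δ        : ℕ
    δ≥1      : 1 ≤ δ
    s        : Fin n
    t0       : ℕ
    t0Range  : 1 ≤ t0 × t0 ≤ T
    r        : Fin n → Status n
    seedOK   : r s ≡ seed t0
    onlySeed : ∀ u t → r u ≡ seed t → u ≡ s
    justified : ∀ u v t → r u ≡ infBy v t →
                adj u v ≡ true × lab u v ≡ t × Infectious r δ v t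
    -- SIR completeness: a susceptible node meeting an infectious
    -- neighbour at an edge time gets infected then (or was earlier)
    complete : ∀ u v → adj u v ≡ true → Infectious r δ v (lab u v) →
               Σ ℕ λ tu → infTime (r u) ≡ just tu × tu ≤ lab u v

countTrue : ∀ {m} → (Fin m → Bool) → ℕ
countTrue {zero}  p = 0
countTrue {suc m} p with p Fin.zero
... | true  = suc (countTrue (λ i → p (Fin.suc i)))
... | false = countTrue (λ i → p (Fin.suc i))

-- number of nodes infected in one round (the same in every round)
infectedCount : ∀ {n} → Instance n → ℕ
infectedCount I = countTrue (λ u → isInfected (Instance.r I u))

data Action (n : ℕ) : Set where
  watch : Fin n → Action n
  name  : Fin n → Action n

-- a deterministic strategy: from the history of (watched node, what was
-- observed about it) — newest first — decide the next action
Strategy : ℕ → Set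
Strategy n = List (Fin n × Status n) → Action n

-- randomized: uniform choice among finitely many deterministic strategies
-- (i.e. an arbitrary distribution with rational probabilities)
record Rand (S : Set) : Set where
  field
    k    : ℕ
    pick : Fin (suc k) → S

prob : ∀ {S} → Rand S → (S → Bool) → ℚ
prob R P = (+ countTrue (λ i → P (Rand.pick R i))) / suc (Rand.k R)

winsWithin : ∀ {n} → Strategy n → Instance n → ℕ → Bool
winsWithin {n} σ I B = go [] 0 (suc B)
  where
  go : List (Fin n × Status n) → ℕ → ℕ → Bool
  go h rounds zero = false
  go h rounds (suc fuel) with σ h
  ... | name u  = ⌊ u ≟ Instance.s I ⌋ ∧ (rounds * infectedCount I ≤ᵇ B)
  ... | watch u = go ((u , Instance.r I u) ∷ h) (suc rounds) fuel

KnownAlg : Set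
KnownAlg = (n T δ : ℕ) → (Fin n → Fin n → Bool) → Rand (Strategy n)

UnknownAlg : Set
UnknownAlg = (n T δ : ℕ) → Rand (Strategy n)

KnownWins : KnownAlg → (ℕ → ℕ) → (ℕ → ℚ) → Set
KnownWins A f g =
  Σ ℕ λ c → Σ ℕ λ n0 → ∀ n → n0 ≤ n → (I : Instance n) →
    g n ≤ℚ prob (A n (Instance.T I) (Instance.δ I) (Instance.adj I))
               (λ σ → winsWithin σ I (c * f n))

UnknownWins : UnknownAlg → (ℕ → ℕ) → (ℕ → ℚ) → Set
UnknownWins A f g =
  Σ ℕ λ c → Σ ℕ λ n0 → ∀ n → n0 ≤ n → (I : Instance n) →
    g n ≤ℚ prob (A n (Instance.T I) (Instance.δ I))
               (λ σ → winsWithin σ I (c * f n))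

{-# OPTIONS --safe #-}

-- The unknown-graph algorithm runs A on the complete graph with the larger
-- lifetime T + δ + 1.  All infections happen by time T, so nobody is infectious
-- at time T + δ + 1.  Giving every non-edge this label therefore turns any
-- instance into one on the complete graph with the same infection chain, hence
-- with the same observations and the same number of infections.

module Submission where

open import Defs
open import Data.Bool using (Bool; true; false; if_then_else_; not)
open import Data.Fin using (Fin; zero; suc)
open import Data.Fin.Properties using (_≟_)
open import Data.Integer using (+_)
open import Data.List using (List; []; _∷_)
open import Data.Maybe using (just)
open import Data.Nat using (ℕ; zero; suc; _+_; _*_; _≤_; z≤n; s≤s)
open import Data.Nat.Properties using (≤-trans; m≤m+n; m≤n⇒m≤1+n; ≤-refl; +-monoˡ-≤; <⇒≱)
open import Data.Product using (Σ; _×_; _,_; proj₁; proj₂)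
open import Data.Rational using (ℚ; _/_) renaming (_≤_ to _≤ℚ_)
open import Function using (_∘_)
open import Relation.Binary.PropositionalEquality using (_≡_; refl; sym; trans; cong; subst; ≢-sym; _≢_)
open import Relation.Nullary using (yes; no; ¬_; contradiction)
open import Relation.Nullary.Decidable using (⌊_⌋)

countTrue-cong : ∀ {m} {p q : Fin m → Bool} → (∀ i → p i ≡ q i) →
                 countTrue p ≡ countTrue q
countTrue-cong {zero}          p≗q = refl
countTrue-cong {suc m} {p} {q} p≗q with p zero | q zero | p≗q zero
... | true  | .true  | refl = cong suc (countTrue-cong (p≗q ∘ suc))
... | false | .false | refl = countTrue-cong (p≗q ∘ suc)

prob-cong : ∀ {S} (R : Rand S) {P Q : S → Bool} → (∀ σ → P σ ≡ Q σ) →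
            prob R P ≡ prob R Q
prob-cong R P≗Q =
  cong (λ c → (+ c) / suc (Rand.k R)) (countTrue-cong (P≗Q ∘ Rand.pick R))

completeAdj : ∀ {n} → Fin n → Fin n → Bool
completeAdj u v = not ⌊ u ≟ v ⌋

completeAdj-≢ : ∀ {n} {u v : Fin n} → u ≢ v → completeAdj u v ≡ true
completeAdj-≢ {u = u} {v} u≢v with u ≟ v
... | yes u≡v = contradiction u≡v u≢v
... | no _    = refl

completeAdj-irr : ∀ {n} (u : Fin n) → completeAdj u u ≡ false
completeAdj-irr u with u ≟ u
... | yes _  = refl
... | no u≢u = contradiction refl u≢u

completeAdj-sym : ∀ {n} (u v : Fin n) → completeAdj u v ≡ completeAdj v u
completeAdj-sym u v with u ≟ v
... | yes refl = sym (completeAdj-irr u)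
... | no u≢v   = sym (completeAdj-≢ (≢-sym u≢v))

module _ {n} (I : Instance n) where
  open Instance I

  adj⇒≢ : ∀ {u v} → adj u v ≡ true → u ≢ v
  adj⇒≢ {u} uv refl with () ← trans (sym uv) (adjIrr u)

  infTime≤T : ∀ v t → infTime (r v) ≡ just t → t ≤ T
  infTime≤T v t eq with r v in rv
  infTime≤T v t refl | seed .t    with refl ← onlySeed v t rv
                                  with refl ← trans (sym rv) seedOK = proj₂ t0Range
  infTime≤T v t refl | infBy w .t with vw , refl , _ ← justified v w t rv =
    proj₂ (labRange v w vw)

  idleTime : ℕ
  idleTime = suc (T + δ)

  T≤idleTime : T ≤ idleTime
  T≤idleTime = m≤n⇒m≤1+n (m≤m+n T δ)

  ¬infectious-idleTime : ∀ v → ¬ Infectious r δ v idleTime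
  ¬infectious-idleTime v (t , eq , _ , idle≤t+δ) =
    <⇒≱ idle≤t+δ (+-monoˡ-≤ δ (infTime≤T v t eq))

  completeLab : Fin n → Fin n → ℕ
  completeLab u v = if adj u v then lab u v else idleTime

  completeLab-sym : ∀ u v → completeLab u v ≡ completeLab v u
  completeLab-sym u v rewrite adjSym u v | labSym u v = refl

  completeLab-range : ∀ u v → 1 ≤ completeLab u v × completeLab u v ≤ idleTime
  completeLab-range u v with adj u v in uv
  ... | true  = proj₁ (labRange u v uv) , ≤-trans (proj₂ (labRange u v uv)) T≤idleTime
  ... | false = s≤s z≤n , ≤-refl

  completeLab-adj : ∀ u v → adj u v ≡ true → completeLab u v ≡ lab u v
  completeLab-adj u v uv rewrite uv = refl

  completeLab-complete : ∀ u v → Infectious r δ v (completeLab u v) →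
                         Σ ℕ λ t → infTime (r u) ≡ just t × t ≤ completeLab u v
  completeLab-complete u v inf with adj u v in uv
  ... | true  = complete u v uv inf
  ... | false = contradiction inf (¬infectious-idleTime v)

  completion : Instance n
  completion = record
    { adj       = completeAdj
    ; adjSym    = completeAdj-sym
    ; adjIrr    = completeAdj-irr
    ; T         = idleTime
    ; lab       = completeLab
    ; labSym    = completeLab-sym
    ; labRange  = λ u v _ → completeLab-range u v
    ; δ         = δ
    ; δ≥1       = δ≥1
    ; s         = s
    ; t0        = t0
    ; t0Range   = proj₁ t0Range , ≤-trans (proj₂ t0Range) T≤idleTime
    ; r         = r
    ; seedOK    = seedOK
    ; onlySeed  = onlySeed
    ; justified = λ u v t ru → let uv , lab≡t , inf = justified u v t ru in
        completeAdj-≢ (adj⇒≢ uv) , trans (completeLab-adj u v uv) lab≡t , inf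
    ; complete  = λ u v _ → completeLab-complete u v
    }

-- The loop inside winsWithin is local to Defs and cannot be named, so the type
-- of play-completion is left to unification with its use in winsWithin-completion.
-- There the with-abstraction replaces the loop's arguments by variables; this
-- is done after the first round, once the bound suc b and the fuel b differ.
mutual
  winsWithin-completion : ∀ {n} (σ : Strategy n) (I : Instance n) (B : ℕ) →
                          winsWithin σ (completion I) B ≡ winsWithin σ I B
  winsWithin-completion σ I zero with σ []
  ... | name _  = refl
  ... | watch _ = refl
  winsWithin-completion σ I (suc b) with σ []
  ... | name _  = refl
  ... | watch u with suc b | (u , Instance.r I u) ∷ [] | 1
  ... | B | h | rounds = play-completion σ I B h rounds b

  play-completion : ∀ {n} (σ : Strategy n) (I : Instance n) (B : ℕ)
                    (h : List (Fin n × Status n)) (rounds fuel : ℕ) → _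
  play-completion σ I B h rounds fuel with σ h
  play-completion σ I B h rounds fuel       | name _  = refl
  play-completion σ I B h rounds zero       | watch _ = refl
  play-completion σ I B h rounds (suc fuel) | watch u =
    play-completion σ I B ((u , Instance.r I u) ∷ h) (suc rounds) fuel

theorem3 : (A : KnownAlg) → Σ UnknownAlg λ Au →
    (f : ℕ → ℕ) (g : ℕ → ℚ) → KnownWins A f g → UnknownWins Au f g
theorem3 A = (λ n T δ → A n (suc (T + δ)) δ completeAdj) , λ f g (c , n₀ , wins) →
  c , n₀ , λ n n₀≤n I →
    subst (g n ≤ℚ_)
      (prob-cong (A n (idleTime I) (Instance.δ I) completeAdj)
        (λ σ → winsWithin-completion σ I (c * f n)))
      (wins n n₀≤n (completion I))
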